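{- Let $G$ be a finite self-complementary symmetric graph of order $n=p^r$ ($p$ prime). Then $\overline{G}\in\mathcal{C}G$ if and only if $n=1$ or $n\equiv 5\pmod 8$.
   Context: A graph is self-complementary if it is isomorphic to its complement $\overline{G}$, and symmetric if it is vertex-transitive and edge-transitive. For a simple graph $G$ and $u\in V(G)$, $Gu$ is the graph with edge set $E(G)\triangle\{[x,y]:x\ne y,\ x,y\in N_G(u)\}$; for a word $s=u_1\cdots u_k$, $Gs=(\cdots(Gu_1)\cdots)u_k$. The complementation class of $G$ is $\mathcal{C}G=\{Gs: s \text{ a word over } V(G)\}$ (graphs on the same labelled vertex set; $\overline{G}\in\mathcal CG$ means equality, not isomorphism). -}

module Defs where

open import Data.Nat using (ℕ)
open import Data.Bool using (Bool; true; false; _xor_; _∧_; not)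
open import Data.Fin using (Fin; _≟_)
open import Data.Fin.Permutation using (Permutation′; _⟨$⟩ʳ_)
open import Data.List using (List; foldl)
open import Data.Product using (Σ; _×_; ∃)
open import Data.Sum using (_⊎_)
open import Relation.Binary.PropositionalEquality using (_≡_)
open import Relation.Nullary.Decidable using (⌊_⌋)

Graph : ℕ → Set
Graph n = Fin n → Fin n → Bool

IsSimple : ∀ {n} → Graph n → Set
IsSimple G = (∀ x y → G x y ≡ G y x) × (∀ x → G x x ≡ false)

_≐_ : ∀ {n} → Graph n → Graph n → Set
G ≐ H = ∀ x y → G x y ≡ H x y

distinct : ∀ {n} → Fin n → Fin n → Bool
distinct x y = not ⌊ x ≟ y ⌋

complement : ∀ {n} → Graph n → Graph n
complement G x y = distinct x y ∧ not (G x y)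

localComp : ∀ {n} → Graph n → Fin n → Graph n
localComp G u x y = G x y xor (distinct x y ∧ (G u x ∧ G u y))

applyWord : ∀ {n} → Graph n → List (Fin n) → Graph n
applyWord G s = foldl localComp G s

-- H ∈ 𝒞G (equality as labelled graphs, not isomorphism).
_∈𝒞_ : ∀ {n} → Graph n → Graph n → Set
H ∈𝒞 G = Σ (List _) λ s → applyWord G s ≐ H

IsIso : ∀ {n} → Graph n → Graph n → Permutation′ n → Set
IsIso G H σ = ∀ x y → G x y ≡ H (σ ⟨$⟩ʳ x) (σ ⟨$⟩ʳ y)

_≅_ : ∀ {n} → Graph n → Graph n → Set
G ≅ H = Σ (Permutation′ _) (IsIso G H)

SelfComplementary : ∀ {n} → Graph n → Set
SelfComplementary G = G ≅ complement G

Automorphism : ∀ {n} → Graph n → Permutation′ n → Set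
Automorphism G σ = IsIso G G σ

VertexTransitive : ∀ {n} → Graph n → Set
VertexTransitive G = ∀ u v → Σ _ λ σ → Automorphism G σ × (σ ⟨$⟩ʳ u ≡ v)

EdgeTransitive : ∀ {n} → Graph n → Set
EdgeTransitive G = ∀ x y u v → G x y ≡ true → G u v ≡ true →
  Σ _ λ σ → Automorphism G σ ×
    (((σ ⟨$⟩ʳ x ≡ u) × (σ ⟨$⟩ʳ y ≡ v)) ⊎ ((σ ⟨$⟩ʳ x ≡ v) × (σ ⟨$⟩ʳ y ≡ u)))

Symmetric : ∀ {n} → Graph n → Set
Symmetric G = VertexTransitive G × EdgeTransitive G

{-# OPTIONS --safe #-}

-- For a self-complementary symmetric graph on more than one vertex, the number k of vertices
-- adjacent to z and neither equal nor adjacent to x is the same for all x ≠ z, because the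
-- automorphisms and the isomorphism to the complement permute all pairs up to reversal.  Counting
-- gives n = 4k + 1 and degree 2k, so n ≡ 5 (mod 8) exactly when k is odd.
--
-- K is reached from G by local complementations iff K (cG + d) = aG + b over 𝔽₂ for some diagonal
-- matrices with ad + bc = 1: a local complementation is a column operation on cG + d and aG + b, and
-- conversely c can be cleared one vertex at a time.  Write Ḡ for the complement.  For k odd,
-- Ḡ (G + I) = G.  For k even, GḠ = 0 and G² = G, which excludes every solution with K = Ḡ.
module Submission where

open import Defs
open import Algebra.Bundles using (CommutativeRing)
import Algebra.Properties.Semiring.Sum as SemiringSum
open import Data.Bool as Bool using (Bool; true; false; T; not; _∧_; _xor_)
open import Data.Bool.Properties as Bool using (xor-∧-commutativeRing)
open import Data.Fin using (Fin; zero; suc; _≟_)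
open import Data.Fin.Permutation using (Permutation′; _⟨$⟩ʳ_; _⟨$⟩ˡ_; inverseˡ)
open import Data.Fin.Properties using (any?; suc-injective)
open import Data.List using (List; []; _∷_)
open import Data.Nat using (ℕ; zero; suc; _+_; _*_; _^_; _%_; ≢-nonZero; ≢-nonZero⁻¹)
open import Data.Nat.DivMod using ([m+n]%n≡m%n)
open import Data.Nat.Primality using (Prime; prime⇒nonZero)
open import Data.Nat.Properties as ℕ using (+-*-semiring)
open import Data.Nat.Tactic.RingSolver using (solve-∀)
open import Data.Product using (∃; ∃₂; _×_; _,_; proj₁; proj₂)
open import Data.Sum using (_⊎_; inj₁; inj₂)
open import Data.Vec.N-ary using (N-ary; Eq)
open import Function using (_∘_; case_of_)
open import Function.Bundles using (module Equivalence)
open import Relation.Binary.PropositionalEquality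
open import Relation.Nullary using (¬_; yes; no; contradiction; _×-dec_)
open import Relation.Nullary.Decidable using (⌊_⌋)

open SemiringSum +-*-semiring using (sum-cong-≗; ∑-distrib-+; ∑-comm; sum-permute; *-distribˡ-sum; *-distribʳ-sum)
  renaming (sum to ∑)
module ⊕ = SemiringSum (CommutativeRing.semiring xor-∧-commutativeRing)
open ⊕ using () renaming (sum to ⨁)

-- Indicators, finite sums and parity.

δ : ∀ {n} → Fin n → Fin n → Bool
δ x y = ⌊ x ≟ y ⌋

⟦_⟧ : Bool → ℕ
⟦ false ⟧ = 0
⟦ true  ⟧ = 1

odd : ℕ → Bool
odd zero    = false
odd (suc n) = not (odd n)

agree? : ∀ n → (f g : N-ary n Bool Bool) → Bool
agree? zero    a b = not (a xor b)
agree? (suc n) f g = agree? n (f true) (g true) ∧ agree? n (f false) (g false)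

-- For concrete `f` and `g` the implicit argument computes to the unit type and is filled in by
-- itself, so a Boolean identity is settled by evaluating every case.
by-truth-table : ∀ n (f g : N-ary n Bool Bool) → {T (agree? n f g)} → Eq n _≡_ f g
by-truth-table zero    true  true        = refl
by-truth-table zero    false false       = refl
by-truth-table (suc n) f g {ok} true     =
  by-truth-table n (f true) (g true) {proj₁ (Equivalence.to Bool.T-∧ ok)}
by-truth-table (suc n) f g {ok} false    =
  by-truth-table n (f false) (g false) {proj₂ (Equivalence.to Bool.T-∧ ok)}

δ-refl : ∀ {n} (x : Fin n) → δ x x ≡ true
δ-refl x with x ≟ x
... | yes _  = refl
... | no x≢x = contradiction refl x≢x

δ-≢ : ∀ {n} {x y : Fin n} → x ≢ y → δ x y ≡ false
δ-≢ {x = x} {y} x≢y with x ≟ y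
... | yes x≡y = contradiction x≡y x≢y
... | no _    = refl

δ-sym : ∀ {n} (x y : Fin n) → δ x y ≡ δ y x
δ-sym x y with x ≟ y
... | yes refl = sym (δ-refl x)
... | no x≢y   = sym (δ-≢ (x≢y ∘ sym))

δ-injective : ∀ {m n} (f : Fin m → Fin n) → (∀ {x y} → f x ≡ f y → x ≡ y) → ∀ x y → δ (f x) (f y) ≡ δ x y
δ-injective f f-inj x y with x ≟ y
... | yes refl = δ-refl (f x)
... | no x≢y   = δ-≢ (x≢y ∘ f-inj)

∑-const : ∀ n k → ∑ {n} (λ _ → k) ≡ n * k
∑-const zero    k = refl
∑-const (suc n) k = cong (k +_) (∑-const n k)

∑-δ : ∀ {n} (x : Fin n) (f : Fin n → Bool) → ∑ (λ w → ⟦ δ x w ∧ f w ⟧) ≡ ⟦ f x ⟧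
∑-δ {suc n} zero    f = trans (cong (⟦ f zero ⟧ +_) (trans (∑-const n 0) (ℕ.*-zeroʳ n))) (ℕ.+-identityʳ _)
∑-δ {suc n} (suc x) f = trans
  (sum-cong-≗ (λ w → cong (λ b → ⟦ b ∧ f (suc w) ⟧) (δ-injective suc suc-injective x w)))
  (∑-δ x (f ∘ suc))

odd-⟦⟧+ : ∀ b k → odd (⟦ b ⟧ + k) ≡ b xor odd k
odd-⟦⟧+ false k = refl
odd-⟦⟧+ true  k = refl

odd-+ : ∀ m n → odd (m + n) ≡ odd m xor odd n
odd-+ zero    n = refl
odd-+ (suc m) n = trans (cong not (odd-+ m n)) (Bool.not-distribˡ-xor (odd m) (odd n))

-- Parity turns `+` into `_xor_`, so counts of vertices become entries of matrix products over 𝔽₂.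
odd-∑ : ∀ {n} (f : Fin n → Bool) → odd (∑ (⟦_⟧ ∘ f)) ≡ ⨁ f
odd-∑ {zero}  f = refl
odd-∑ {suc n} f = trans (odd-⟦⟧+ (f zero) _) (cong (f zero xor_) (odd-∑ (f ∘ suc)))

⨁-δ : ∀ {n} (x : Fin n) (f : Fin n → Bool) → ⨁ (λ w → f w ∧ δ w x) ≡ f x
⨁-δ x f = begin
  ⨁ (λ w → f w ∧ δ w x)           ≡⟨ ⊕.sum-cong-≗ (λ w → trans (Bool.∧-comm (f w) _) (cong (_∧ f w) (δ-sym w x))) ⟩
  ⨁ (λ w → δ x w ∧ f w)           ≡⟨ odd-∑ (λ w → δ x w ∧ f w) ⟨
  odd (∑ (λ w → ⟦ δ x w ∧ f w ⟧)) ≡⟨ cong odd (∑-δ x f) ⟩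
  odd ⟦ f x ⟧                     ≡⟨ odd-⟦⟧ (f x) ⟩
  f x                             ∎
  where
  open ≡-Reasoning
  odd-⟦⟧ : ∀ b → odd ⟦ b ⟧ ≡ b
  odd-⟦⟧ false = refl
  odd-⟦⟧ true  = refl

-- Local complementation

localComp-simple : ∀ {n} {G : Graph n} → IsSimple G → ∀ u → IsSimple (localComp G u)
localComp-simple {G = G} (G-sym , G-irr) u = sym′ , irr′
  where
  sym′ : ∀ x y → localComp G u x y ≡ localComp G u y x
  sym′ x y rewrite δ-sym x y | G-sym x y | Bool.∧-comm (G u x) (G u y) = refl
  irr′ : ∀ x → localComp G u x x ≡ false
  irr′ x rewrite δ-refl x = trans (Bool.xor-identityʳ _) (G-irr x)

-- As `u` is not its own neighbour, no toggled pair contains `u`. A second complementation at `u`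
-- therefore toggles the same pairs again.
localComp-nbr : ∀ {n} {G : Graph n} → IsSimple G → ∀ u x → localComp G u u x ≡ G u x
localComp-nbr {G = G} (_ , G-irr) u x
  rewrite G-irr u | Bool.∧-zeroʳ (distinct u x) = Bool.xor-identityʳ (G u x)

localComp-involutive : ∀ {n} {G : Graph n} → IsSimple G → ∀ u → localComp (localComp G u) u ≐ G
localComp-involutive {G = G} G-simple u x y
  rewrite localComp-nbr G-simple u x | localComp-nbr G-simple u y =
  by-truth-table 2 (λ g t → (g xor t) xor t) (λ g t → g) (G x y) (distinct x y ∧ (G u x ∧ G u y))

-- Local complementation as a column operation.

-- At each vertex v, an invertible matrix (a b ; c d) over 𝔽₂.
record LocalClifford (n : ℕ) : Set where
  field
    a b c d : Fin n → Bool
    det     : ∀ v → (a v ∧ d v) xor (b v ∧ c v) ≡ true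

-- The matrix fG + g over 𝔽₂, with f and g read as diagonal matrices.
affine : ∀ {n} (f g : Fin n → Bool) → Graph n → Graph n
affine f g G x z = (f x ∧ G x z) xor (g x ∧ δ x z)

-- K (cG + d) = aG + b over 𝔽₂.
Transforms : ∀ {n} → LocalClifford n → Graph n → Graph n → Set
Transforms Q G K = ∀ x z → ⨁ (λ w → K x w ∧ affine c d G w z) ≡ affine a b G x z
  where open LocalClifford Q

identity : ∀ {n} → LocalClifford n
identity = record { a = λ _ → true ; b = λ _ → false ; c = λ _ → false ; d = λ _ → true ; det = λ _ → refl }

-- The matrix at x is multiplied on the right by (1 g ; e 1) with g = `G u x` and e = `δ u x`. Since
-- `G` has no loop at `u`, g and e are never both 1, and this factor has determinant 1.
shift : ∀ {n} {G : Graph n} → IsSimple G → Fin n → LocalClifford n → LocalClifford n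
shift {G = G} (_ , G-irr) u Q = record
  { a = λ x → a x xor (b x ∧ δ u x)
  ; b = λ x → b x xor (a x ∧ G u x)
  ; c = λ x → c x xor (d x ∧ δ u x)
  ; d = λ x → d x xor (c x ∧ G u x)
  ; det = λ x → trans (det-preserved x) (det x)
  }
  where
  open LocalClifford Q
  det-preserved : ∀ x → ((a x xor (b x ∧ δ u x)) ∧ (d x xor (c x ∧ G u x))) xor
                        ((b x xor (a x ∧ G u x)) ∧ (c x xor (d x ∧ δ u x)))
                      ≡ (a x ∧ d x) xor (b x ∧ c x)
  det-preserved x with u ≟ x
  ... | yes refl rewrite G-irr u = by-truth-table 4
    (λ a b c d → ((a xor (b ∧ true)) ∧ (d xor (c ∧ false))) xor ((b xor (a ∧ false)) ∧ (c xor (d ∧ true))))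
    (λ a b c d → (a ∧ d) xor (b ∧ c)) (a u) (b u) (c u) (d u)
  ... | no _ = by-truth-table 5
    (λ a b c d g → ((a xor (b ∧ false)) ∧ (d xor (c ∧ g))) xor ((b xor (a ∧ g)) ∧ (c xor (d ∧ false))))
    (λ a b c d g → (a ∧ d) xor (b ∧ c)) (a x) (b x) (c x) (d x) (G u x)

-- Local complementation at u adds column u to the columns of the neighbours of u.
affine-localComp : ∀ {n} {G : Graph n} → IsSimple G → ∀ u (f g : Fin n → Bool) x z →
  affine (λ y → f y xor (g y ∧ δ u y)) (λ y → g y xor (f y ∧ G u y)) (localComp G u) x z
    ≡ affine f g G x z xor (G u z ∧ affine f g G x u)
affine-localComp {G = G} (G-sym , G-irr) u f g x z
  rewrite δ-sym x u with u ≟ x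
... | yes refl rewrite G-irr u | Bool.∧-zeroʳ (distinct u z) = by-truth-table 4
  (λ f g h e → ((f xor (g ∧ true)) ∧ (h xor false)) xor ((g xor (f ∧ false)) ∧ e))
  (λ f g h e → ((f ∧ h) xor (g ∧ e)) xor (h ∧ ((f ∧ false) xor (g ∧ true))))
  (f u) (g u) (G u z) (δ u z)
... | no _ with x ≟ z
...   | yes refl rewrite G-sym x u = by-truth-table 4
  (λ f g h k → ((f xor (g ∧ false)) ∧ (k xor false)) xor ((g xor (f ∧ h)) ∧ true))
  (λ f g h k → ((f ∧ k) xor (g ∧ true)) xor (h ∧ ((f ∧ h) xor (g ∧ false))))
  (f x) (g x) (G u x) (G x x)
...   | no _ rewrite G-sym x u = by-truth-table 5
  (λ f g h k l → ((f xor (g ∧ false)) ∧ (k xor (h ∧ l))) xor ((g xor (f ∧ h)) ∧ false))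
  (λ f g h k l → ((f ∧ k) xor (g ∧ false)) xor (l ∧ ((f ∧ h) xor (g ∧ false))))
  (f x) (g x) (G u x) (G x z) (G u z)

-- Passing to `localComp G u` multiplies cG + d and aG + b on the right by the same matrix, so the
-- factor `K` on the left is untouched.
shift-transforms : ∀ {n} {G K : Graph n} (G-simple : IsSimple G) u {Q} →
  Transforms Q G K → Transforms (shift G-simple u Q) (localComp G u) K
shift-transforms {G = G} {K} G-simple u {Q} tr x z = begin
  ⨁ (λ w → K x w ∧ affine c′ d′ (localComp G u) w z)
    ≡⟨ ⊕.sum-cong-≗ (λ w → trans (cong (K x w ∧_) (affine-localComp G-simple u c d w z))
         (by-truth-table 4 (λ k p h q → k ∧ (p xor (h ∧ q))) (λ k p h q → (k ∧ p) xor (h ∧ (k ∧ q)))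
            (K x w) (affine c d G w z) (G u z) (affine c d G w u))) ⟩
  ⨁ (λ w → (K x w ∧ affine c d G w z) xor (G u z ∧ (K x w ∧ affine c d G w u)))
    ≡⟨ ⊕.∑-distrib-+ (λ w → K x w ∧ affine c d G w z) _ ⟩
  ⨁ (λ w → K x w ∧ affine c d G w z) xor ⨁ (λ w → G u z ∧ (K x w ∧ affine c d G w u))
    ≡⟨ cong₂ _xor_ (tr x z) (trans
         (sym (⊕.*-distribˡ-sum (G u z) (λ w → K x w ∧ affine c d G w u))) (cong (G u z ∧_) (tr x u))) ⟩
  affine a b G x z xor (G u z ∧ affine a b G x u)
    ≡⟨ affine-localComp G-simple u a b x z ⟨
  affine a′ b′ (localComp G u) x z ∎
  where
  open ≡-Reasoning
  open LocalClifford Q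
  open LocalClifford (shift G-simple u Q) using () renaming (a to a′; b to b′; c to c′; d to d′)

Transforms-cong : ∀ {n} {G H K : Graph n} Q → G ≐ H → Transforms Q G K → Transforms Q H K
Transforms-cong {G = G} {H} {K} Q G≐H tr x z = begin
  ⨁ (λ w → K x w ∧ affine c d H w z) ≡⟨ ⊕.sum-cong-≗ (λ w → cong (K x w ∧_) (affine-cong c d w z)) ⟨
  ⨁ (λ w → K x w ∧ affine c d G w z) ≡⟨ tr x z ⟩
  affine a b G x z                   ≡⟨ affine-cong a b x z ⟩
  affine a b H x z                   ∎
  where
  open ≡-Reasoning
  open LocalClifford Q
  affine-cong : ∀ f g x z → affine f g G x z ≡ affine f g H x z
  affine-cong f g x z = cong (λ e → (f x ∧ e) xor (g x ∧ δ x z)) (G≐H x z)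

-- Induction on the word. The recursive call relates `localComp G u` to `K`; a shift at `u` then
-- leads back to `G`, because local complementation is an involution.
∈𝒞⇒transforms : ∀ {n} {G K : Graph n} → IsSimple G → K ∈𝒞 G → ∃ λ Q → Transforms Q G K
∈𝒞⇒transforms {G = G} {K} G-simple ([] , G≐K) = identity , λ x z → begin
  ⨁ (λ w → K x w ∧ δ w z)         ≡⟨ ⨁-δ z (K x) ⟩
  K x z                           ≡⟨ G≐K x z ⟨
  G x z                           ≡⟨ Bool.xor-identityʳ (G x z) ⟨
  G x z xor false                 ∎
  where open ≡-Reasoning
∈𝒞⇒transforms {G = G} G-simple (u ∷ s , Gs≐K) =
  let G′-simple = localComp-simple G-simple u
      Q , tr    = ∈𝒞⇒transforms G′-simple (s , Gs≐K)
      Q′        = shift G′-simple u Q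
  in Q′ , Transforms-cong Q′ (localComp-involutive G-simple u) (shift-transforms G′-simple u {Q} tr)

∈𝒞-step : ∀ {n} {G K : Graph n} u → K ∈𝒞 localComp G u → K ∈𝒞 G
∈𝒞-step u (s , eq) = u ∷ s , eq

-- Each round clears one bit of c, so the number of bits set is the termination measure.
transforms⇒∈𝒞 : ∀ {n} {G K : Graph n} → IsSimple G → IsSimple K → ∀ Q → Transforms Q G K → K ∈𝒞 G
transforms⇒∈𝒞 {n} {K = K} G-simple₀ (_ , K-irr) Q₀ tr₀ = clear _ G-simple₀ Q₀ tr₀ refl
  where
  open LocalClifford

  clear : ∀ m {G} → IsSimple G → ∀ Q → Transforms Q G K → ∑ (⟦_⟧ ∘ c Q) ≡ m → K ∈𝒞 G

  -- The shift at `v` adds `d v` to `c v` and changes `c` nowhere else, so one bit disappears.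
  clear-at : ∀ m {G} → IsSimple G → ∀ Q → Transforms Q G K → ∑ (⟦_⟧ ∘ c Q) ≡ m →
             ∀ v → c Q v ≡ true → d Q v ≡ true → K ∈𝒞 G
  clear-at m {G} G-simple Q tr ∑c v cv dv = continue m (trans (sym ∑c) c-drops)
    where
    Q′ = shift G-simple v Q
    pointwise : ∀ x → ⟦ c Q x ⟧ ≡ ⟦ δ v x ∧ true ⟧ + ⟦ c Q′ x ⟧
    pointwise x with v ≟ x
    ... | yes refl rewrite cv | dv = refl
    ... | no _ rewrite Bool.∧-zeroʳ (d Q x) = cong ⟦_⟧ (sym (Bool.xor-identityʳ (c Q x)))
    c-drops : ∑ (⟦_⟧ ∘ c Q) ≡ suc (∑ (⟦_⟧ ∘ c Q′))
    c-drops = trans (sum-cong-≗ pointwise)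
      (trans (∑-distrib-+ (λ x → ⟦ δ v x ∧ true ⟧) _) (cong (_+ ∑ (⟦_⟧ ∘ c Q′)) (∑-δ v (λ _ → true))))
    continue : ∀ m → m ≡ suc (∑ (⟦_⟧ ∘ c Q′)) → K ∈𝒞 G
    continue zero ()
    continue (suc m) eq = ∈𝒞-step v
      (clear m (localComp-simple G-simple v) Q′ (shift-transforms G-simple v {Q} tr) (sym (ℕ.suc-injective eq)))

  clear m {G} G-simple@(G-sym , G-irr) Q tr ∑c with any? (λ v → c Q v Bool.≟ true)
  -- With c = 0 the determinant forces a = d = 1, and the equation becomes K = G + b. As b is
  -- diagonal and both graphs are loopless, K = G.
  ... | no no-c = [] , G≐K
    where
    c≡0 : ∀ v → c Q v ≡ false
    c≡0 v = Bool.¬-not (λ cv → no-c (v , cv))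
    units : ∀ v → a Q v ≡ true × d Q v ≡ true
    units v with a Q v | b Q v | c Q v | d Q v | det Q v | c≡0 v
    ... | true | _ | false | true | _ | _ = refl , refl
    ... | true  | false | false | false | () | _
    ... | true  | true  | false | false | () | _
    ... | false | false | false | _ | () | _
    ... | false | true  | false | _ | () | _
    G≐K : G ≐ K
    G≐K x z with x ≟ z | tr x z
    ... | yes refl | _ = trans (G-irr x) (sym (K-irr x))
    ... | no _ | eq rewrite proj₁ (units x) | Bool.∧-zeroʳ (b Q x) = begin
      G x z                                  ≡⟨ Bool.xor-identityʳ (G x z) ⟨
      G x z xor false                        ≡⟨ eq ⟨
      ⨁ (λ w → K x w ∧ affine (c Q) (d Q) G w z)
        ≡⟨ ⊕.sum-cong-≗ (λ w → cong₂ (λ c d → K x w ∧ ((c ∧ G w z) xor (d ∧ δ w z))) (c≡0 w) (proj₂ (units w))) ⟩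
      ⨁ (λ w → K x w ∧ δ w z)                ≡⟨ ⨁-δ z (K x) ⟩
      K x z                                  ∎
      where open ≡-Reasoning
  ... | yes (u , cu) with any? (λ v → c Q v Bool.≟ true ×-dec d Q v Bool.≟ true)
  ...   | yes (v , cv , dv) = clear-at m G-simple Q tr ∑c v cv dv
  ...   | no no-cd with any? (λ v → c Q v Bool.≟ true ×-dec G u v Bool.≟ true)
  -- As d u = 0, complementing at u keeps c and makes d v = 1, so that v can be cleared.
  ...     | yes (v , cv , uv) = ∈𝒞-step u
    (clear-at m (localComp-simple G-simple u) (shift G-simple u Q) (shift-transforms G-simple u {Q} tr)
      (trans (sum-cong-≗ (λ x → cong ⟦_⟧ (c-same x))) ∑c) v (trans (c-same v) cv) d′v)
    where
    d≡0 : ∀ x → c Q x ≡ true → d Q x ≡ false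
    d≡0 x cx = Bool.¬-not (λ dx → no-cd (x , cx , dx))
    c-same : ∀ x → c Q x xor (d Q x ∧ δ u x) ≡ c Q x
    c-same x with u ≟ x
    ... | yes refl rewrite d≡0 u cu = Bool.xor-identityʳ _
    ... | no _ rewrite Bool.∧-zeroʳ (d Q x) = Bool.xor-identityʳ _
    d′v : d Q v xor (c Q v ∧ G u v) ≡ true
    d′v rewrite d≡0 v cv | cv | uv = refl
  -- Column u of cG + d vanishes, whereas aG + b has the entry b u = 1 there.
  ...     | no no-cG = contradiction (trans (sym bu) (trans (sym entry) row)) (λ ())
    where
    du : d Q u ≡ false
    du = Bool.¬-not (λ dx → no-cd (u , cu , dx))
    bu : b Q u ≡ true
    bu with det Q u
    ... | eq rewrite du | cu | Bool.∧-zeroʳ (a Q u) | Bool.∧-identityʳ (b Q u) = eq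
    entry : affine (a Q) (b Q) G u u ≡ b Q u
    entry rewrite G-irr u | δ-refl u | Bool.∧-zeroʳ (a Q u) = Bool.∧-identityʳ (b Q u)
    column : ∀ w → affine (c Q) (d Q) G w u ≡ false
    column w with w ≟ u
    ... | yes refl rewrite G-irr u | du = trans (Bool.xor-identityʳ _) (Bool.∧-zeroʳ (c Q u))
    ... | no _ with c Q w in cw
    ...   | true  rewrite Bool.∧-zeroʳ (d Q w) | G-sym w u = trans (Bool.xor-identityʳ _) (Bool.¬-not (λ uw → no-cG (w , cw , uw)))
    ...   | false = Bool.∧-zeroʳ (d Q w)
    row : affine (a Q) (b Q) G u u ≡ false
    row = trans (sym (tr u u)) (trans
      (⊕.sum-cong-≗ (λ w → trans (cong (K u w ∧_) (column w)) (Bool.∧-zeroʳ (K u w))))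
      (⊕.sum-replicate-zero n))

-- Strongly regular structure

⟨$⟩ʳ-injective : ∀ {n} (σ : Permutation′ n) {x y} → σ ⟨$⟩ʳ x ≡ σ ⟨$⟩ʳ y → x ≡ y
⟨$⟩ʳ-injective σ eq = trans (sym (inverseˡ σ)) (trans (cong (σ ⟨$⟩ˡ_) eq) (inverseˡ σ))

complement-iso : ∀ {n} {G H : Graph n} σ → IsIso G H σ → IsIso (complement G) (complement H) σ
complement-iso σ iso x y = cong₂ (λ e g → not e ∧ not g)
  (sym (δ-injective (σ ⟨$⟩ʳ_) (⟨$⟩ʳ-injective σ) x y)) (iso x y)

complement-simple : ∀ {n} {G : Graph n} → IsSimple G → IsSimple (complement G)
complement-simple {G = G} (G-sym , _) =
  (λ x y → cong₂ (λ e g → not e ∧ not g) (δ-sym x y) (G-sym x y)) ,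
  (λ x → cong (λ e → not e ∧ not (G x x)) (δ-refl x))

complement-involutive : ∀ {n} {G : Graph n} → IsSimple G → complement (complement G) ≐ G
complement-involutive {G = G} (_ , G-irr) x y with x ≟ y
... | yes refl = sym (G-irr x)
... | no _     = Bool.not-involutive (G x y)

degree : ∀ {n} → Graph n → Fin n → ℕ
degree G v = ∑ (λ w → ⟦ G v w ⟧)

-- The (x, z) entry of the integer matrix product AB.
walks : ∀ {n} → Graph n → Graph n → Fin n → Fin n → ℕ
walks A B x z = ∑ (λ w → ⟦ A x w ∧ B w z ⟧)

degree-iso : ∀ {n} {G H : Graph n} σ → IsIso G H σ → ∀ v → degree G v ≡ degree H (σ ⟨$⟩ʳ v)
degree-iso {G = G} {H} σ iso v =
  trans (sum-cong-≗ (λ w → cong ⟦_⟧ (iso v w))) (sym (sum-permute (λ w → ⟦ H (σ ⟨$⟩ʳ v) w ⟧) σ))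

walks-iso : ∀ {n} {A A′ B B′ : Graph n} σ → IsIso A A′ σ → IsIso B B′ σ →
  ∀ x z → walks A B x z ≡ walks A′ B′ (σ ⟨$⟩ʳ x) (σ ⟨$⟩ʳ z)
walks-iso {A′ = A′} {B′ = B′} σ isoA isoB x z = trans
  (sum-cong-≗ (λ w → cong₂ (λ a b → ⟦ a ∧ b ⟧) (isoA x w) (isoB w z)))
  (sym (sum-permute (λ w → ⟦ A′ (σ ⟨$⟩ʳ x) w ∧ B′ w (σ ⟨$⟩ʳ z) ⟧) σ))

walks-reverse : ∀ {n} {A B : Graph n} → IsSimple A → IsSimple B → ∀ x z → walks A B x z ≡ walks B A z x
walks-reverse {A = A} {B} (A-sym , _) (B-sym , _) x z = sum-cong-≗ (λ w → cong ⟦_⟧ (begin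
  A x w ∧ B w z ≡⟨ cong₂ _∧_ (A-sym x w) (B-sym w z) ⟩
  A w x ∧ B z w ≡⟨ Bool.∧-comm (A w x) (B z w) ⟩
  B z w ∧ A w x ∎))
  where open ≡-Reasoning

degree-complement : ∀ {n} {G : Graph n} → IsSimple G → ∀ v → 1 + (degree G v + degree (complement G) v) ≡ n
degree-complement {n} {G} (_ , G-irr) v = begin
  1 + (degree G v + degree (complement G) v)
    -- The 1 counts `v` itself; the conjunct `true` brings its indicator into the shape of `∑-δ`.
    ≡⟨ cong₂ _+_ (∑-δ v (λ _ → true)) (∑-distrib-+ (λ w → ⟦ G v w ⟧) _) ⟨
  ∑ (λ w → ⟦ δ v w ∧ true ⟧) + ∑ (λ w → ⟦ G v w ⟧ + ⟦ complement G v w ⟧)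
    ≡⟨ ∑-distrib-+ (λ w → ⟦ δ v w ∧ true ⟧) _ ⟨
  ∑ (λ w → ⟦ δ v w ∧ true ⟧ + (⟦ G v w ⟧ + ⟦ complement G v w ⟧))
    ≡⟨ sum-cong-≗ pointwise ⟩
  ∑ {n} (λ _ → 1)
    ≡⟨ ∑-const n 1 ⟩
  n * 1
    ≡⟨ ℕ.*-identityʳ n ⟩
  n ∎
  where
  open ≡-Reasoning
  pointwise : ∀ w → ⟦ δ v w ∧ true ⟧ + (⟦ G v w ⟧ + ⟦ complement G v w ⟧) ≡ 1
  pointwise w with v ≟ w
  ... | yes refl rewrite G-irr v = refl
  ... | no _ with G v w
  ...   | true  = refl
  ...   | false = refl

-- A neighbour of `z` is `x` itself, a non-neighbour of `x` or a neighbour of `x`; the three terms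
-- count these cases.
walks-partition : ∀ {n} {G : Graph n} → IsSimple G → ∀ x z →
  ⟦ G x z ⟧ + (walks (complement G) G x z + walks G G x z) ≡ degree G z
walks-partition {G = G} (G-sym , G-irr) x z = begin
  ⟦ G x z ⟧ + (walks (complement G) G x z + walks G G x z)
    ≡⟨ cong₂ _+_ (∑-δ x (λ w → G w z)) (∑-distrib-+ (λ w → ⟦ complement G x w ∧ G w z ⟧) _) ⟨
  ∑ (λ w → ⟦ δ x w ∧ G w z ⟧) + ∑ (λ w → ⟦ complement G x w ∧ G w z ⟧ + ⟦ G x w ∧ G w z ⟧)
    ≡⟨ ∑-distrib-+ (λ w → ⟦ δ x w ∧ G w z ⟧) _ ⟨
  ∑ (λ w → ⟦ δ x w ∧ G w z ⟧ + (⟦ complement G x w ∧ G w z ⟧ + ⟦ G x w ∧ G w z ⟧))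
    ≡⟨ sum-cong-≗ (λ w → trans (pointwise w) (cong ⟦_⟧ (G-sym w z))) ⟩
  degree G z ∎
  where
  open ≡-Reasoning
  pointwise : ∀ w → ⟦ δ x w ∧ G w z ⟧ + (⟦ complement G x w ∧ G w z ⟧ + ⟦ G x w ∧ G w z ⟧) ≡ ⟦ G w z ⟧
  pointwise w with x ≟ w
  ... | yes refl rewrite G-irr x = ℕ.+-identityʳ _
  ... | no _ with G x w
  ...   | true  = refl
  ...   | false = ℕ.+-identityʳ _

walks-complement-loop : ∀ {n} {G : Graph n} → IsSimple G → ∀ z → walks (complement G) G z z ≡ 0
walks-complement-loop {n} {G} (G-sym , _) z =
  trans (sum-cong-≗ (λ w → cong ⟦_⟧ (pointwise w))) (trans (∑-const n 0) (ℕ.*-zeroʳ n))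
  where
  pointwise : ∀ w → complement G z w ∧ G w z ≡ false
  pointwise w rewrite G-sym w z =
    by-truth-table 2 (λ e g → (e ∧ not g) ∧ g) (λ e g → false) (distinct z w) (G z w)

-- Summing over the middle vertex last, each `w` with `B w z` contributes its column sum in `A`.
∑-walks : ∀ {n} (A B : Graph n) z d → (∀ w → ∑ (λ x → ⟦ A x w ⟧) ≡ d) →
  ∑ (λ x → walks A B x z) ≡ d * ∑ (λ w → ⟦ B w z ⟧)
∑-walks A B z d regular = begin
  ∑ (λ x → walks A B x z)                  ≡⟨ ∑-comm (λ x w → ⟦ A x w ∧ B w z ⟧) ⟩
  ∑ (λ w → ∑ (λ x → ⟦ A x w ∧ B w z ⟧))    ≡⟨ sum-cong-≗ (λ w → begin
      ∑ (λ x → ⟦ A x w ∧ B w z ⟧)            ≡⟨ sum-cong-≗ (λ x → ⟦⟧-∧ (A x w) (B w z)) ⟩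
      ∑ (λ x → ⟦ A x w ⟧ * ⟦ B w z ⟧)        ≡⟨ *-distribʳ-sum ⟦ B w z ⟧ (λ x → ⟦ A x w ⟧) ⟨
      ∑ (λ x → ⟦ A x w ⟧) * ⟦ B w z ⟧        ≡⟨ cong (_* ⟦ B w z ⟧) (regular w) ⟩
      d * ⟦ B w z ⟧                          ∎) ⟩
  ∑ (λ w → d * ⟦ B w z ⟧)                  ≡⟨ *-distribˡ-sum d (λ w → ⟦ B w z ⟧) ⟨
  d * ∑ (λ w → ⟦ B w z ⟧)                  ∎
  where
  open ≡-Reasoning
  ⟦⟧-∧ : ∀ a b → ⟦ a ∧ b ⟧ ≡ ⟦ a ⟧ * ⟦ b ⟧
  ⟦⟧-∧ false _ = refl
  ⟦⟧-∧ true  b = sym (ℕ.+-identityʳ ⟦ b ⟧)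

-- The parameters of a conference graph: adjacent vertices have k - 1 common neighbours, distinct
-- non-adjacent ones k. Counting mixed walks instead gives one value for both kinds of pairs.
record Conference {n} (G : Graph n) (k : ℕ) : Set where
  field
    order       : n ≡ 1 + k * 4
    regular     : ∀ v → degree G v ≡ k + k
    mixed-walks : ∀ x z → x ≢ z → walks (complement G) G x z ≡ k
    edge        : ∃₂ λ u v → G u v ≡ true

module SelfComplementarySymmetric {n} {G : Graph n} (G-simple : IsSimple G)
  (self-complementary : SelfComplementary G) (symmetric : Symmetric G)
  (o o′ : Fin n) (o≢o′ : o ≢ o′) where

  private
    Ḡ = complement G
    Ḡ-simple = complement-simple G-simple
    φ = proj₁ self-complementary
    φ-iso = proj₂ self-complementary

    φ-iso′ : IsIso Ḡ G φ
    φ-iso′ x y = trans (complement-iso {H = Ḡ} φ φ-iso x y) (complement-involutive G-simple _ _)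

  regular : ∀ u v → degree G u ≡ degree G v
  regular u v with proj₁ symmetric u v
  ... | σ , aut , refl = degree-iso {H = G} σ aut u

  -- In `walks-partition` the degree is constant and every other term is symmetric in `x` and `z`,
  -- so this one is too.
  mixed-sym : ∀ x z → walks Ḡ G x z ≡ walks Ḡ G z x
  mixed-sym x z = ℕ.+-cancelʳ-≡ (walks G G x z) _ _ (ℕ.+-cancelˡ-≡ ⟦ G x z ⟧ _ _ (begin
    ⟦ G x z ⟧ + (walks Ḡ G x z + walks G G x z) ≡⟨ walks-partition G-simple x z ⟩
    degree G z                                  ≡⟨ regular z x ⟩
    degree G x                                  ≡⟨ walks-partition G-simple z x ⟨
    ⟦ G z x ⟧ + (walks Ḡ G z x + walks G G z x) ≡⟨ cong₂ (λ g c → ⟦ g ⟧ + (walks Ḡ G z x + c))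
                                                     (proj₁ G-simple z x) (walks-reverse G-simple G-simple z x) ⟩
    ⟦ G x z ⟧ + (walks Ḡ G z x + walks G G x z) ∎))
    where open ≡-Reasoning

  -- Edge-transitivity may reverse the edge; `mixed-sym` absorbs the reversal.
  mixed-on-edges : ∀ {x z u v} → G x z ≡ true → G u v ≡ true → walks Ḡ G x z ≡ walks Ḡ G u v
  mixed-on-edges {x} {z} xz uv with proj₂ symmetric _ _ _ _ xz uv
  ... | σ , aut , inj₁ (refl , refl) = walks-iso {A′ = Ḡ} {B′ = G} σ (complement-iso {H = G} σ aut) aut x z
  ... | σ , aut , inj₂ (refl , refl) =
    trans (walks-iso {A′ = Ḡ} {B′ = G} σ (complement-iso {H = G} σ aut) aut x z) (mixed-sym (σ ⟨$⟩ʳ x) (σ ⟨$⟩ʳ z))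

  -- On a non-adjacent pair `φ` yields an edge but exchanges `G` and `Ḡ`. Reversing the walks
  -- restores the order of the factors, and `mixed-sym` that of the endpoints.
  edge-with-same-mixed : ∀ x z → x ≢ z → ∃₂ λ u v → G u v ≡ true × walks Ḡ G x z ≡ walks Ḡ G u v
  edge-with-same-mixed x z x≢z with G x z in xz
  ... | true  = x , z , xz , refl
  ... | false = φ ⟨$⟩ʳ x , φ ⟨$⟩ʳ z , trans (sym (φ-iso′ x z)) x̄z , (begin
    walks Ḡ G x z                        ≡⟨ walks-iso {A′ = G} {B′ = Ḡ} φ φ-iso′ φ-iso x z ⟩
    walks G Ḡ (φ ⟨$⟩ʳ x) (φ ⟨$⟩ʳ z)      ≡⟨ walks-reverse G-simple Ḡ-simple _ _ ⟩
    walks Ḡ G (φ ⟨$⟩ʳ z) (φ ⟨$⟩ʳ x)      ≡⟨ mixed-sym (φ ⟨$⟩ʳ z) (φ ⟨$⟩ʳ x) ⟩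
    walks Ḡ G (φ ⟨$⟩ʳ x) (φ ⟨$⟩ʳ z)      ∎)
    where
    open ≡-Reasoning
    x̄z : Ḡ x z ≡ true
    x̄z rewrite δ-≢ x≢z | xz = refl

  mixed-constant : ∀ x z u v → x ≢ z → u ≢ v → walks Ḡ G x z ≡ walks Ḡ G u v
  mixed-constant x z u v x≢z u≢v =
    let _ , _ , e  , eq  = edge-with-same-mixed x z x≢z
        _ , _ , e′ , eq′ = edge-with-same-mixed u v u≢v
    in trans eq (trans (mixed-on-edges e e′) (sym eq′))

  private
    d = degree G o
    k = walks Ḡ G o o′

  degree≡d : ∀ v → degree G v ≡ d
  degree≡d v = regular v o

  degreeḠ≡d : ∀ v → degree Ḡ v ≡ d
  degreeḠ≡d v = trans (degree-iso {H = G} φ φ-iso′ v) (degree≡d _)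

  order≡1+2d : n ≡ 1 + (d + d)
  order≡1+2d = trans (sym (degree-complement G-simple o)) (cong (λ e → 1 + (d + e)) (degreeḠ≡d o))

  -- This permits cancelling `d` in the counting equation below.
  d≢0 : d ≢ 0
  d≢0 d≡0 = n≢1 o o′ o≢o′ (trans order≡1+2d (cong (λ d → 1 + (d + d)) d≡0))
    where
    n≢1 : ∀ {n} (x y : Fin n) → x ≢ y → n ≢ 1
    n≢1 zero zero x≢y refl = x≢y refl

  -- Column `o` of the product ḠG is summed in two ways: through the middle vertex it gives d²,
  -- while each entry is `k` except for the 0 at `o`. The extra `k` fills that gap and avoids
  -- subtraction.
  ∑-mixed : k + d * d ≡ n * k
  ∑-mixed = begin
    k + d * d
      ≡⟨ cong₂ (λ s t → s + d * t) k≡ (sum-cong-≗ (λ w → cong ⟦_⟧ (proj₁ G-simple w o))) ⟨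
    ∑ (λ x → k * ⟦ δ o x ∧ true ⟧) + d * ∑ (λ w → ⟦ G w o ⟧)
      ≡⟨ cong (∑ (λ x → k * ⟦ δ o x ∧ true ⟧) +_) (∑-walks Ḡ G o d column-sum) ⟨
    ∑ (λ x → k * ⟦ δ o x ∧ true ⟧) + ∑ (λ x → walks Ḡ G x o)
      ≡⟨ ∑-distrib-+ (λ x → k * ⟦ δ o x ∧ true ⟧) _ ⟨
    ∑ (λ x → k * ⟦ δ o x ∧ true ⟧ + walks Ḡ G x o)
      ≡⟨ sum-cong-≗ pointwise ⟩
    ∑ {n} (λ _ → k)
      ≡⟨ ∑-const n k ⟩
    n * k ∎
    where
    open ≡-Reasoning
    k≡ : ∑ (λ x → k * ⟦ δ o x ∧ true ⟧) ≡ k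
    k≡ = trans (sym (*-distribˡ-sum k (λ x → ⟦ δ o x ∧ true ⟧)))
      (trans (cong (k *_) (∑-δ o (λ _ → true))) (ℕ.*-identityʳ k))
    column-sum : ∀ w → ∑ (λ x → ⟦ Ḡ x w ⟧) ≡ d
    column-sum w = trans (sum-cong-≗ (λ x → cong ⟦_⟧ (proj₁ Ḡ-simple x w))) (degreeḠ≡d w)
    pointwise : ∀ x → k * ⟦ δ o x ∧ true ⟧ + walks Ḡ G x o ≡ k
    pointwise x with o ≟ x
    ... | yes refl = trans (cong₂ _+_ (ℕ.*-identityʳ k) (walks-complement-loop G-simple o)) (ℕ.+-identityʳ k)
    ... | no o≢x   = trans (cong (_+ walks Ḡ G x o) (ℕ.*-zeroʳ k)) (mixed-constant x o o o′ (o≢x ∘ sym) o≢o′)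

  -- (2d + 1) k = k + d².
  d≡2k : d ≡ k + k
  d≡2k = ℕ.*-cancelˡ-≡ d (k + k) d ⦃ ≢-nonZero d≢0 ⦄
    (ℕ.+-cancelˡ-≡ k _ _ (trans ∑-mixed (trans (cong (_* k) order≡1+2d) (expand d k))))
    where
    expand : ∀ d k → (1 + (d + d)) * k ≡ k + d * (k + k)
    expand = solve-∀

  conference : Conference G k
  conference = record
    { order       = trans order≡1+2d (trans (cong (λ d → 1 + (d + d)) d≡2k) (cong suc (quadruple k)))
    ; regular     = λ v → trans (degree≡d v) d≡2k
    ; mixed-walks = λ x z x≢z → mixed-constant x z o o′ x≢z o≢o′
    ; edge        = let u , v , uv , _ = edge-with-same-mixed o o′ o≢o′ in u , v , uv
    }
    where
    quadruple : ∀ k → (k + k) + (k + k) ≡ k * 4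
    quadruple = solve-∀

-- Parity of the conference parameter

module ConferenceParity {n k} {G : Graph n} (G-simple : IsSimple G) (conference : Conference G k) where
  open Conference conference
  private
    Ḡ = complement G
    Ḡ-simple = complement-simple G-simple

  -- Over 𝔽₂ this is ḠG = k(J + I) with J the all-ones matrix. The diagonal vanishes because no
  -- vertex is both a neighbour and a non-neighbour of `x`.
  mixed-parity : ∀ x z → ⨁ (λ w → Ḡ x w ∧ G w z) ≡ distinct x z ∧ odd k
  mixed-parity x z = trans (sym (odd-∑ (λ w → Ḡ x w ∧ G w z))) parity
    where
    parity : odd (walks Ḡ G x z) ≡ distinct x z ∧ odd k
    parity with x ≟ z
    ... | yes refl = cong odd (walks-complement-loop G-simple x)
    ... | no x≢z   = cong odd (mixed-walks x z x≢z)

  -- Modulo 2, `walks-partition` loses its mixed term and the degree 2k, leaving G + G² = 0.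
  G²-parity : odd k ≡ false → ∀ x z → ⨁ (λ w → G x w ∧ G w z) ≡ G x z
  G²-parity k-even x z = trans (sym (odd-∑ (λ w → G x w ∧ G w z)))
    (by-cancellation (G x z) _ (begin
      G x z xor odd (walks G G x z)
        ≡⟨ cong (λ e → G x z xor (e xor odd (walks G G x z))) mixed-even ⟨
      G x z xor (odd (walks Ḡ G x z) xor odd (walks G G x z))
        ≡⟨ cong (G x z xor_) (odd-+ (walks Ḡ G x z) _) ⟨
      G x z xor odd (walks Ḡ G x z + walks G G x z)
        ≡⟨ odd-⟦⟧+ (G x z) _ ⟨
      odd (⟦ G x z ⟧ + (walks Ḡ G x z + walks G G x z))
        ≡⟨ cong odd (trans (walks-partition G-simple x z) (regular z)) ⟩
      odd (k + k)
        ≡⟨ trans (odd-+ k k) (Bool.xor-same (odd k)) ⟩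
      false ∎))
    where
    open ≡-Reasoning
    mixed-even : odd (walks Ḡ G x z) ≡ false
    mixed-even = trans (odd-∑ (λ w → Ḡ x w ∧ G w z))
      (trans (mixed-parity x z) (trans (cong (distinct x z ∧_) k-even) (Bool.∧-zeroʳ _)))
    by-cancellation : ∀ a b → a xor b ≡ false → b ≡ a
    by-cancellation false false _ = refl
    by-cancellation true  true  _ = refl

  -- The case a = c = d = 1, b = 0: complement G = G (G + I)⁻¹.
  odd⇒complement∈𝒞 : odd k ≡ true → Ḡ ∈𝒞 G
  odd⇒complement∈𝒞 k-odd = transforms⇒∈𝒞 G-simple Ḡ-simple Q transforms
    where
    Q : LocalClifford n
    Q = record { a = λ _ → true ; b = λ _ → false ; c = λ _ → true ; d = λ _ → true ; det = λ _ → refl }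
    transforms : Transforms Q G Ḡ
    transforms x z = begin
      ⨁ (λ w → Ḡ x w ∧ (G w z xor δ w z))
        ≡⟨ ⊕.sum-cong-≗ (λ w → Bool.∧-distribˡ-xor (Ḡ x w) (G w z) (δ w z)) ⟩
      ⨁ (λ w → (Ḡ x w ∧ G w z) xor (Ḡ x w ∧ δ w z))
        ≡⟨ ⊕.∑-distrib-+ (λ w → Ḡ x w ∧ G w z) _ ⟩
      ⨁ (λ w → Ḡ x w ∧ G w z) xor ⨁ (λ w → Ḡ x w ∧ δ w z)
        ≡⟨ cong₂ _xor_ (trans (mixed-parity x z) (cong (distinct x z ∧_) k-odd)) (⨁-δ z (Ḡ x)) ⟩
      -- In matrix form, (J + I) + Ḡ = G.
      (distinct x z ∧ true) xor Ḡ x z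
        ≡⟨ entry ⟩
      G x z xor false ∎
      where
      open ≡-Reasoning
      entry : (distinct x z ∧ true) xor Ḡ x z ≡ G x z xor false
      entry with x ≟ z
      ... | yes refl = sym (trans (Bool.xor-identityʳ _) (proj₂ G-simple x))
      ... | no _     = by-truth-table 1 (λ g → true xor not g) (λ g → g xor false) (G x z)

  -- The diagonal of Ḡ (cG + d) = aG + b gives b = 0, hence a = 1; since GḠ = 0 and G² = G,
  -- multiplying by G on the left then gives 0 = G.
  even⇒complement∉𝒞 : odd k ≡ false → ¬ (Ḡ ∈𝒞 G)
  even⇒complement∉𝒞 k-even Ḡ∈𝒞G = case trans (sym uv) (G≡0 u v) of λ ()
    where
    open ≡-Reasoning
    u = proj₁ edge
    v = proj₁ (proj₂ edge)
    uv = proj₂ (proj₂ edge)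
    Q = proj₁ (∈𝒞⇒transforms G-simple Ḡ∈𝒞G)
    transforms = proj₂ (∈𝒞⇒transforms G-simple Ḡ∈𝒞G)
    open LocalClifford Q

    M : Graph n
    M = affine c d G

    b≡0 : ∀ x → b x ≡ false
    b≡0 x = begin
      b x                       ≡⟨ diagonal ⟨
      affine a b G x x          ≡⟨ transforms x x ⟨
      ⨁ (λ w → Ḡ x w ∧ M w x)   ≡⟨ ⊕.sum-cong-≗ vanishes ⟩
      ⨁ {n} (λ _ → false)       ≡⟨ ⊕.sum-replicate-zero n ⟩
      false                     ∎
      where
      diagonal : affine a b G x x ≡ b x
      diagonal rewrite proj₂ G-simple x | δ-refl x | Bool.∧-zeroʳ (a x) = Bool.∧-identityʳ (b x)
      -- `Ḡ x w` excludes both `w` = `x` and adjacency, which are the only ways for `M w x` to be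
      -- nonzero.
      vanishes : ∀ w → Ḡ x w ∧ M w x ≡ false
      vanishes w rewrite proj₁ G-simple w x | δ-sym w x = by-truth-table 4
        (λ e g c d → (not e ∧ not g) ∧ ((c ∧ g) xor (d ∧ e))) (λ e g c d → false) (δ x w) (G x w) (c w) (d w)

    a≡1 : ∀ x → a x ≡ true
    a≡1 x with a x | b x | b≡0 x | det x
    ... | true  | _     | _    | _ = refl
    ... | false | false | refl | ()

    G≡ḠM : ∀ x z → G x z ≡ ⨁ (λ w → Ḡ x w ∧ M w z)
    G≡ḠM x z = sym (trans (transforms x z)
      (trans (cong₂ (λ a b → (a ∧ G x z) xor (b ∧ δ x z)) (a≡1 x) (b≡0 x)) (Bool.xor-identityʳ (G x z))))

    GḠ≡0 : ∀ y w → ⨁ (λ x → G y x ∧ Ḡ x w) ≡ false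
    GḠ≡0 y w = begin
      ⨁ (λ x → G y x ∧ Ḡ x w)   ≡⟨ odd-∑ (λ x → G y x ∧ Ḡ x w) ⟨
      odd (walks G Ḡ y w)       ≡⟨ cong odd (walks-reverse G-simple Ḡ-simple y w) ⟩
      odd (walks Ḡ G w y)       ≡⟨ odd-∑ (λ x → Ḡ w x ∧ G x y) ⟩
      ⨁ (λ x → Ḡ w x ∧ G x y)   ≡⟨ mixed-parity w y ⟩
      distinct w y ∧ odd k      ≡⟨ cong (distinct w y ∧_) k-even ⟩
      distinct w y ∧ false      ≡⟨ Bool.∧-zeroʳ _ ⟩
      false                     ∎

    G≡0 : ∀ y z → G y z ≡ false
    G≡0 y z = begin
      G y z
        ≡⟨ G²-parity k-even y z ⟨
      ⨁ (λ x → G y x ∧ G x z)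
        ≡⟨ ⊕.sum-cong-≗ (λ x → trans (cong (G y x ∧_) (G≡ḠM x z)) (⊕.*-distribˡ-sum (G y x) (λ w → Ḡ x w ∧ M w z))) ⟩
      ⨁ (λ x → ⨁ (λ w → G y x ∧ (Ḡ x w ∧ M w z)))
        ≡⟨ ⊕.∑-comm (λ x w → G y x ∧ (Ḡ x w ∧ M w z)) ⟩
      ⨁ (λ w → ⨁ (λ x → G y x ∧ (Ḡ x w ∧ M w z)))
        ≡⟨ ⊕.sum-cong-≗ (λ w → begin
             ⨁ (λ x → G y x ∧ (Ḡ x w ∧ M w z)) ≡⟨ ⊕.sum-cong-≗ (λ x → sym (Bool.∧-assoc (G y x) (Ḡ x w) (M w z))) ⟩
             ⨁ (λ x → (G y x ∧ Ḡ x w) ∧ M w z) ≡⟨ ⊕.*-distribʳ-sum (M w z) (λ x → G y x ∧ Ḡ x w) ⟨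
             ⨁ (λ x → G y x ∧ Ḡ x w) ∧ M w z   ≡⟨ cong (_∧ M w z) (GḠ≡0 y w) ⟩
             false                             ∎) ⟩
      ⨁ {n} (λ _ → false)
        ≡⟨ ⊕.sum-replicate-zero n ⟩
      false ∎

-- The order modulo 8 and the conclusion.

[1+k*4]%8 : ∀ k → (1 + k * 4) % 8 ≡ 1 + ⟦ odd k ⟧ * 4
[1+k*4]%8 zero          = refl
[1+k*4]%8 (suc zero)    = refl
-- Raising `k` by 2 adds 8 and keeps its parity.
[1+k*4]%8 (suc (suc k)) = begin
  (9 + k * 4) % 8                   ≡⟨ cong (λ j → suc j % 8) (ℕ.+-comm 8 (k * 4)) ⟩
  (1 + k * 4 + 8) % 8               ≡⟨ [m+n]%n≡m%n (1 + k * 4) 8 ⟩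
  (1 + k * 4) % 8                   ≡⟨ [1+k*4]%8 k ⟩
  1 + ⟦ odd k ⟧ * 4                 ≡⟨ cong (λ b → 1 + ⟦ b ⟧ * 4) (Bool.not-involutive (odd k)) ⟨
  1 + ⟦ odd (suc (suc k)) ⟧ * 4     ∎
  where open ≡-Reasoning

theorem1p7p12 : (n p r : ℕ) → Prime p → n ≡ p ^ r → (G : Graph n) →
    IsSimple G → SelfComplementary G → Symmetric G →
    ((complement G ∈𝒞 G → (n ≡ 1 ⊎ n % 8 ≡ 5)) × ((n ≡ 1 ⊎ n % 8 ≡ 5) → complement G ∈𝒞 G))
-- A power of a prime is nonzero, so order 0 does not occur.
theorem1p7p12 zero p r p-prime 0≡p^r G _ _ _ = contradiction (sym 0≡p^r) (≢-nonZero⁻¹ (p ^ r))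
  where instance
    _ = prime⇒nonZero p-prime
    _ = ℕ.m^n≢0 p r
-- On one vertex the graph equals its complement, and the empty word suffices.
theorem1p7p12 (suc zero) p r _ _ G (_ , G-irr) _ _ =
  (λ _ → inj₁ refl) , (λ _ → [] , λ { zero zero → G-irr zero })
theorem1p7p12 n@(suc (suc m)) p r _ _ G G-simple self-complementary symmetric = to , from
  where
  -- By `mixed-constant` every pair of distinct vertices gives this count; the first two are taken.
  k = walks (complement G) G zero (suc zero)
  conference : Conference G k
  conference = SelfComplementarySymmetric.conference G-simple self-complementary symmetric zero (suc zero) (λ ())
  open ConferenceParity G-simple conference

  n%8 : ∀ {e} → odd k ≡ e → n % 8 ≡ 1 + ⟦ e ⟧ * 4
  n%8 eq = trans (cong (_% 8) (Conference.order conference))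
    (trans ([1+k*4]%8 k) (cong (λ e → 1 + ⟦ e ⟧ * 4) eq))

  to : complement G ∈𝒞 G → n ≡ 1 ⊎ n % 8 ≡ 5
  to Ḡ∈𝒞G with odd k in eq
  ... | true  = inj₂ (n%8 eq)
  ... | false = contradiction Ḡ∈𝒞G (even⇒complement∉𝒞 eq)

  from : n ≡ 1 ⊎ n % 8 ≡ 5 → complement G ∈𝒞 G
  from (inj₁ ())
  from (inj₂ n≡5) with odd k in eq
  ... | true  = odd⇒complement∈𝒞 eq
  -- An even `k` would give residue 1.
  ... | false = case trans (sym n≡5) (n%8 eq) of λ ()
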